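{- Let $\varrho\in\mathcal{R}_p(1)$. Then: (a) the map $f_\varrho:\mathrm{CExt}\mathbf{E}\to\mathrm{CExt}\mathbf{E}$, $f_\varrho(\mathbf{S})=\mathbf{S}_\varrho:=\{\varphi*\varrho:\varphi\in\mathbf{S}\}$, is well defined (i.e. $\mathbf{S}_\varrho$, closed under $\approx$, is again a classical modal logic) and is a lattice automorphism of $\mathrm{CExt}\mathbf{E}$; (b) the set $\mathcal{A}_p(1)=\{f_\varrho:\varrho\in\mathcal{R}_p(1)\}$ is a group (under composition of maps) of automorphisms of $\mathrm{CExt}\mathbf{E}$, and it is isomorphic to the symmetric group $\mathrm{S}_4$.
   Context: Language: propositional variables $p_1,p_2,\dots$, constants $0$ (falsum) and $1$ (verum), connectives $\neg,\vee$ (with $\wedge,\to,\leftrightarrow$ as the usual abbreviations) and one modal operator $\lozenge$; $\square\varphi$ abbreviates $\neg\lozenge\neg\varphi$. The minimal classical modal logic $\mathbf{E}$ is the smallest set of formulas containing all propositional tautologies and closed under modus ponens (MP), uniform substitution (US) and the congruence rule RE: from $\varphi\leftrightarrow\psi$ infer $\lozenge\varphi\leftrightarrow\lozenge\psi$. A classical modal logic is a set of formulas containing $\mathbf{E}$ and closed under MP, US and RE; $\mathrm{CExt}\mathbf{E}$ is the set of all classical modal logics (including the inconsistent logic $\mathbf{F}$ of all formulas), ordered by inclusion; it is a lattice whose meet is $\mathbf{S}'\cap\mathbf{S}''$ and whose join is the closure of $\mathbf{S}'\cup\mathbf{S}''$ under MP, US and RE. Write $\varphi\approx\psi$ if $\vdash_{\mathbf{E}}\varphi\leftrightarrow\psi$.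 Uniform replacements (URs): a UR is a formula $\rho(e)$ of modal degree at most 1 in the single variable $e$ (considered up to $\approx$). For any formula $\varphi$, the formula $\varphi*\rho$ is defined recursively by: $0*\rho=0$, $1*\rho=1$, $p_i*\rho=p_i$, $(\psi\vee\theta)*\rho=(\psi*\rho)\vee(\theta*\rho)$, $(\neg\psi)*\rho=\neg(\psi*\rho)$, $(\lozenge\psi)*\rho=\rho(\psi*\rho)$ (the result of substituting $\psi*\rho$ for $e$ in $\rho(e)$); abbreviated connectives and $\square$ are first expanded. The composition of URs is $\rho\rho':=\rho*\rho'$ (the UR $\rho'$ applied to the formula $\rho(e)$). $\mathcal{R}_p(1)$ (the prime URs) is the following set of 24 URs: all formulas $\lambda\leftrightarrow\tau$ with $\lambda\in\{\lozenge e,\neg\lozenge e\}$ and $\tau\in\{1,\ e,\ e\vee\lozenge\neg e,\ e\vee\neg\lozenge\neg e,\ \neg e\vee\lozenge\neg e,\ \neg e\vee\neg\lozenge\neg e\}$, together with all formulas $\lambda\leftrightarrow\tau$ with $\lambda\in\{\lozenge\neg e,\neg\lozenge\neg e\}$ and $\tau\in\{1,\ e,\ e\vee\lozenge e,\ e\vee\neg\lozenge e,\ \neg e\vee\lozenge e,\ \neg e\vee\neg\lozenge e\}$ (so e.g. $\lozenge e\leftrightarrow 1$ is just $\lozenge e$). -}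

module Defs where

open import Data.Nat using (ℕ; zero; suc)
open import Data.Bool using (Bool; true; false; not; _∨_)
open import Data.Fin using (Fin; zero; suc)
open import Data.Product using (Σ; ∃; _×_; _,_)
open import Data.Sum using (_⊎_)
open import Relation.Binary.PropositionalEquality using (_≡_)
open import Data.Fin.Permutation using (Permutation′; _∘ₚ_)
import Data.Fin.Permutation as P

-- Formulas: variables p_0, p_1, ... (var 0 doubles as the UR variable e),
-- constants 0 (falsum) and 1 (verum), ¬, ∨, ◇.

data Fm : Set where
  var  : ℕ → Fm
  ⊥'   : Fm
  ⊤'   : Fm
  ¬'_  : Fm → Fm
  _∨'_ : Fm → Fm → Fm
  ◇_   : Fm → Fm

infix 9 ¬'_ ◇_ □_
infixr 7 _∧'_
infixr 6 _∨'_
infixr 5 _⇒'_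
infix 4 _⇔'_

_∧'_ : Fm → Fm → Fm
φ ∧' ψ = ¬' (¬' φ ∨' ¬' ψ)

_⇒'_ : Fm → Fm → Fm
φ ⇒' ψ = ¬' φ ∨' ψ

_⇔'_ : Fm → Fm → Fm
φ ⇔' ψ = (φ ⇒' ψ) ∧' (ψ ⇒' φ)

□_ : Fm → Fm
□ φ = ¬' ◇ ¬' φ

eval : (ℕ → Bool) → (Fm → Bool) → Fm → Bool
eval v w (var n)  = v n
eval v w ⊥'       = false
eval v w ⊤'       = true
eval v w (¬' φ)   = not (eval v w φ)
eval v w (φ ∨' ψ) = eval v w φ ∨ eval v w ψ
eval v w (◇ φ)    = w (◇ φ)

Tautology : Fm → Set
Tautology φ = ∀ v w → eval v w φ ≡ true

subst : (ℕ → Fm) → Fm → Fm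
subst σ (var n)  = σ n
subst σ ⊥'       = ⊥'
subst σ ⊤'       = ⊤'
subst σ (¬' φ)   = ¬' subst σ φ
subst σ (φ ∨' ψ) = subst σ φ ∨' subst σ ψ
subst σ (◇ φ)    = ◇ subst σ φ

data E : Fm → Set where
  taut : ∀ {φ} → Tautology φ → E φ
  mp   : ∀ {φ ψ} → E φ → E (φ ⇒' ψ) → E ψ
  us   : ∀ {φ} (σ : ℕ → Fm) → E φ → E (subst σ φ)
  re   : ∀ {φ ψ} → E (φ ⇔' ψ) → E (◇ φ ⇔' ◇ ψ)

_≈_ : Fm → Fm → Set
φ ≈ ψ = E (φ ⇔' ψ)

FmSet : Set₁
FmSet = Fm → Set

_⊆_ : FmSet → FmSet → Set
S ⊆ T = ∀ φ → S φ → T φ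

_≐_ : FmSet → FmSet → Set
S ≐ T = (S ⊆ T) × (T ⊆ S)

record ClassicalLogic (S : FmSet) : Set where
  field
    containsE : E ⊆ S
    closedMP  : ∀ {φ ψ} → S φ → S (φ ⇒' ψ) → S ψ
    closedUS  : ∀ {φ} (σ : ℕ → Fm) → S φ → S (subst σ φ)
    closedRE  : ∀ {φ ψ} → S (φ ⇔' ψ) → S (◇ φ ⇔' ◇ ψ)

Meet : FmSet → FmSet → FmSet
Meet S T φ = S φ × T φ

data Join (S T : FmSet) : Fm → Set where
  inl  : ∀ {φ} → S φ → Join S T φ
  inr  : ∀ {φ} → T φ → Join S T φ
  mp   : ∀ {φ ψ} → Join S T φ → Join S T (φ ⇒' ψ) → Join S T ψ
  us   : ∀ {φ} (σ : ℕ → Fm) → Join S T φ → Join S T (subst σ φ)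
  re   : ∀ {φ ψ} → Join S T (φ ⇔' ψ) → Join S T (◇ φ ⇔' ◇ ψ)

-- Uniform replacements.  A UR ρ(e) is a formula whose only variable is
-- e = var 0; ρ(ψ) substitutes ψ for e.

sub-e : Fm → Fm → Fm
sub-e ψ ρ = subst σ ρ
  where
  σ : ℕ → Fm
  σ zero    = ψ
  σ (suc n) = var (suc n)

e : Fm
e = var 0

_*_ : Fm → Fm → Fm
var n    * ρ = var n
⊥'       * ρ = ⊥'
⊤'       * ρ = ⊤'
(¬' φ)   * ρ = ¬' (φ * ρ)
(φ ∨' ψ) * ρ = (φ * ρ) ∨' (ψ * ρ)
(◇ φ)    * ρ = sub-e (φ * ρ) ρ

Img : Fm → FmSet → FmSet
Img ρ S ψ = Σ Fm λ φ → S φ × (ψ ≈ (φ * ρ))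

-- The 24 prime URs R_p(1), indexed by
--   d : Bool  (false: λ ∈ {◇e, ¬◇e}; true: λ ∈ {◇¬e, ¬◇¬e}),
--   n : Bool  (whether λ is negated),
--   t : Fin 6 (choice of τ, in the order listed in the paper).
-- For τ = 1 the UR λ ↔ 1 is taken to be λ itself.

PrimeIdx : Set
PrimeIdx = Bool × Bool × Fin 6

lam : Bool → Bool → Fm
lam false false = ◇ e
lam false true  = ¬' ◇ e
lam true  false = ◇ ¬' e
lam true  true  = ¬' ◇ ¬' e

oth : Bool → Fm
oth false = ◇ ¬' e
oth true  = ◇ e

prime : PrimeIdx → Fm
prime (d , n , zero)                               = lam d n
prime (d , n , suc zero)                           = lam d n ⇔' e
prime (d , n , suc (suc zero))                     = lam d n ⇔' (e ∨' oth d)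
prime (d , n , suc (suc (suc zero)))               = lam d n ⇔' (e ∨' ¬' oth d)
prime (d , n , suc (suc (suc (suc zero))))         = lam d n ⇔' (¬' e ∨' oth d)
prime (d , n , suc (suc (suc (suc (suc zero)))))   = lam d n ⇔' (¬' e ∨' ¬' oth d)

f : PrimeIdx → FmSet → FmSet
f i = Img (prime i)

_≗L_ : (FmSet → FmSet) → (FmSet → FmSet) → Set₁
F ≗L G = ∀ S → ClassicalLogic S → F S ≐ G S

IsAutomorphism : (FmSet → FmSet) → Set₁
IsAutomorphism F =
    (∀ S → ClassicalLogic S → ClassicalLogic (F S))
  × (∀ S T → ClassicalLogic S → ClassicalLogic T → F S ≐ F T → S ≐ T)
  × (∀ T → ClassicalLogic T → Σ FmSet λ S → ClassicalLogic S × (F S ≐ T))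
  × (∀ S T → ClassicalLogic S → ClassicalLogic T → F (Meet S T) ≐ Meet (F S) (F T))
  × (∀ S T → ClassicalLogic S → ClassicalLogic T → F (Join S T) ≐ Join (F S) (F T))

IsGroupOfMaps : Set₁
IsGroupOfMaps =
    (∀ i j → Σ PrimeIdx λ k → f k ≗L (λ S → f i (f j S)))
  × (Σ PrimeIdx λ k → f k ≗L (λ S → S))
  × (∀ i → Σ PrimeIdx λ j → (λ S → f i (f j S)) ≗L (λ S → S))

IsoToS4 : Set₁
IsoToS4 = Σ (Permutation′ 4 → PrimeIdx) λ h →
    (∀ π π' → f (h (π ∘ₚ π')) ≗L (λ S → f (h π) (f (h π') S)))
  × (∀ π π' → f (h π) ≗L f (h π') → π P.≈ π')
  × (∀ i → Σ (Permutation′ 4) λ π → f (h π) ≗L f i)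

{-# OPTIONS --safe #-}
-- Up to ≈, a UR ρ(e) is a Boolean combination of e, ◇e and ◇¬e.  Among e and
-- ¬e one is true (T) and the other false (F), so ρ amounts to a self-map of the
-- four states (◇T , ◇F), and composition of URs is composition of these maps.
-- The prime URs induce exactly the 24 permutations of the states; in particular
-- they are invertible, so the image of a logic S under ρ is its preimage
-- under ρ⁻¹, from which all lattice-theoretic claims follow.  The action on
-- logics is faithful because it permutes the logics of the four one-point
-- neighbourhood frames, which are determined by the state.
module Submission where

open import Defs
open import Data.Bool using (Bool; true; false; not; _∨_; if_then_else_)
open import Data.Bool.Properties using (not-involutive)
open import Data.Fin using (Fin)
open import Data.Fin.Patterns using (0F; 1F; 2F; 3F; 4F; 5F)
open import Data.Fin.Permutation using (Permutation′; permutation; _⟨$⟩ʳ_; _∘ₚ_)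
open import Data.Fin.Properties using (_≟_; all?; any?)
open import Data.Nat using (ℕ; zero; suc)
open import Data.Product using (Σ; ∃; _×_; _,_; proj₁; proj₂)
open import Data.Sum using ([_,_]; inj₁; inj₂)
open import Function using (_∘_; case_of_)
open import Function.Bundles using (module Injection)
open import Function.Properties.Inverse using (Inverse⇒Injection)
open import Relation.Binary.PropositionalEquality using (_≡_; _≢_; refl; sym; trans; cong; cong₂; module ≡-Reasoning) renaming (subst to transport)
open import Relation.Nullary using (Dec; ¬?; _×-dec_; _⊎-dec_; _→-dec_)
open import Relation.Nullary.Decidable using (from-yes; map′)
open import Relation.Unary using (Decidable)

open ClassicalLogic

-- Derived rules

-- Spelled with `not` and `_∨_` exactly as `_⇔'_` unfolds, so that `eval v w (φ ⇔' ψ)` is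
-- definitionally an `iff`.
iff : Bool → Bool → Bool
iff a b = not (not (not a ∨ b) ∨ not (not b ∨ a))

iff-refl : ∀ a → iff a a ≡ true
iff-refl true  = refl
iff-refl false = refl

iff⇒≡ : ∀ a b → iff a b ≡ true → a ≡ b
iff⇒≡ true  true  _ = refl
iff⇒≡ false false _ = refl

≡⇒iff : ∀ {a b} → a ≡ b → iff a b ≡ true
≡⇒iff {a} refl = iff-refl a

⇒-true : ∀ a b → (a ≡ true → b ≡ true) → not a ∨ b ≡ true
⇒-true true  b h = h refl
⇒-true false b h = refl

true-⇒ : ∀ {a b} → a ≡ true → not a ∨ b ≡ true → b ≡ true
true-⇒ refl h = h

E-logic : ClassicalLogic E
E-logic .containsE _ p = p
E-logic .closedMP      = E.mp
E-logic .closedUS      = E.us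
E-logic .closedRE      = E.re

module Rules {S : FmSet} (L : ClassicalLogic S) where

  -- Propositional steps are carried out semantically. Since `w` gives each formula `◇ χ` an
  -- arbitrary value, the hypothesis says that `φ ⇒' ψ` is a tautology, and modus ponens finishes.
  entail₁ : ∀ {φ ψ} → (∀ v w → eval v w φ ≡ true → eval v w ψ ≡ true) → S φ → S ψ
  entail₁ {φ} {ψ} h p =
    L .closedMP p (L .containsE _ (taut λ v w → ⇒-true (eval v w φ) (eval v w ψ) (h v w)))

  entail₂ : ∀ {φ ψ χ} → (∀ v w → eval v w φ ≡ true → eval v w ψ ≡ true → eval v w χ ≡ true) →
            S φ → S ψ → S χ
  entail₂ {φ} {ψ} {χ} h p q = L .closedMP q
    (entail₁ {φ} {ψ ⇒' χ} (λ v w a → ⇒-true (eval v w ψ) (eval v w χ) (h v w a)) p)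

  ⇔-refl : ∀ {φ} → S (φ ⇔' φ)
  ⇔-refl {φ} = L .containsE _ (taut λ v w → iff-refl (eval v w φ))

  ⇔-reflexive : ∀ {φ ψ} → φ ≡ ψ → S (φ ⇔' ψ)
  ⇔-reflexive refl = ⇔-refl

  ⇔-sym : ∀ {φ ψ} → S (φ ⇔' ψ) → S (ψ ⇔' φ)
  ⇔-sym {φ} {ψ} = entail₁ {φ ⇔' ψ} {ψ ⇔' φ} λ v w h → ≡⇒iff (sym (iff⇒≡ (eval v w φ) (eval v w ψ) h))

  ⇔-trans : ∀ {φ ψ χ} → S (φ ⇔' ψ) → S (ψ ⇔' χ) → S (φ ⇔' χ)
  ⇔-trans {φ} {ψ} {χ} = entail₂ {φ ⇔' ψ} {ψ ⇔' χ} {φ ⇔' χ}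
    λ v w h k → ≡⇒iff (trans (iff⇒≡ (eval v w φ) (eval v w ψ) h)
                           (iff⇒≡ (eval v w ψ) (eval v w χ) k))

  ¬-cong : ∀ {φ ψ} → S (φ ⇔' ψ) → S (¬' φ ⇔' ¬' ψ)
  ¬-cong {φ} {ψ} = entail₁ {φ ⇔' ψ} {¬' φ ⇔' ¬' ψ}
    λ v w h → ≡⇒iff (cong not (iff⇒≡ (eval v w φ) (eval v w ψ) h))

  ∨-cong : ∀ {φ φ′ ψ ψ′} → S (φ ⇔' φ′) → S (ψ ⇔' ψ′) → S ((φ ∨' ψ) ⇔' (φ′ ∨' ψ′))
  ∨-cong {φ} {φ′} {ψ} {ψ′} = entail₂ {φ ⇔' φ′} {ψ ⇔' ψ′} {(φ ∨' ψ) ⇔' (φ′ ∨' ψ′)}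
    λ v w h k → ≡⇒iff (cong₂ _∨_ (iff⇒≡ (eval v w φ) (eval v w φ′) h)
                               (iff⇒≡ (eval v w ψ) (eval v w ψ′) k))

  subst-cong : ∀ {σ τ} χ → (∀ n → S (σ n ⇔' τ n)) → S (subst σ χ ⇔' subst τ χ)
  subst-cong (var n)  h = h n
  subst-cong ⊥'       h = ⇔-refl
  subst-cong ⊤'       h = ⇔-refl
  subst-cong (¬' χ)   h = ¬-cong (subst-cong χ h)
  subst-cong (χ ∨' θ) h = ∨-cong (subst-cong χ h) (subst-cong θ h)
  subst-cong (◇ χ)    h = L .closedRE (subst-cong χ h)

  sub-e-cong : ∀ {φ ψ} χ → S (φ ⇔' ψ) → S (sub-e φ χ ⇔' sub-e ψ χ)
  sub-e-cong χ p = subst-cong χ λ where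
    zero    → p
    (suc n) → ⇔-refl

  resp-≈ : ∀ {φ ψ} → φ ≈ ψ → S φ → S ψ
  resp-≈ {φ} {ψ} p = entail₂ {φ ⇔' ψ} {φ} {ψ}
    (λ v w h k → trans (sym (iff⇒≡ (eval v w φ) (eval v w ψ) h)) k) (L .containsE _ p)

open Rules E-logic using () renaming
  (⇔-refl to ≈-refl; ⇔-reflexive to ≈-reflexive; ⇔-sym to ≈-sym; ⇔-trans to ≈-trans;
   ¬-cong to ≈-¬-cong; ∨-cong to ≈-∨-cong; sub-e-cong to ≈-sub-e-cong; entail₁ to E-entail₁)

-- Uniform replacements as Boolean functions

-- The common shape of the 24 prime URs. As `◇` is applied only to `e` and `¬' e`, each UR is a
-- Boolean function of three atoms, and facts about it follow by recursion on this predicate.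
data UR : Fm → Set where
  e-ur   : UR e
  ◇e-ur  : UR (◇ e)
  ◇¬e-ur : UR (◇ ¬' e)
  ¬-ur   : ∀ {ρ} → UR ρ → UR (¬' ρ)
  ∨-ur   : ∀ {ρ ρ′} → UR ρ → UR ρ′ → UR (ρ ∨' ρ′)

value : ∀ {ρ} → UR ρ → Bool → Bool → Bool → Bool
value e-ur       a x y = a
value ◇e-ur      a x y = x
value ◇¬e-ur     a x y = y
value (¬-ur u)   a x y = not (value u a x y)
value (∨-ur u t) a x y = value u a x y ∨ value t a x y

⇔-ur : ∀ {ρ ρ′} → UR ρ → UR ρ′ → UR (ρ ⇔' ρ′)
⇔-ur u t = ¬-ur (∨-ur (¬-ur (∨-ur (¬-ur u) t)) (¬-ur (∨-ur (¬-ur t) u)))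

lam-ur : ∀ d n → UR (lam d n)
lam-ur false false = ◇e-ur
lam-ur false true  = ¬-ur ◇e-ur
lam-ur true  false = ◇¬e-ur
lam-ur true  true  = ¬-ur ◇¬e-ur

oth-ur : ∀ d → UR (oth d)
oth-ur false = ◇¬e-ur
oth-ur true  = ◇e-ur

prime-ur : ∀ i → UR (prime i)
prime-ur (d , n , 0F) = lam-ur d n
prime-ur (d , n , 1F) = ⇔-ur (lam-ur d n) e-ur
prime-ur (d , n , 2F) = ⇔-ur (lam-ur d n) (∨-ur e-ur (oth-ur d))
prime-ur (d , n , 3F) = ⇔-ur (lam-ur d n) (∨-ur e-ur (¬-ur (oth-ur d)))
prime-ur (d , n , 4F) = ⇔-ur (lam-ur d n) (∨-ur (¬-ur e-ur) (oth-ur d))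
prime-ur (d , n , 5F) = ⇔-ur (lam-ur d n) (∨-ur (¬-ur e-ur) (¬-ur (oth-ur d)))

eval-sub-e : ∀ {ρ} (u : UR ρ) v w ψ →
             eval v w (sub-e ψ ρ) ≡ value u (eval v w ψ) (w (◇ ψ)) (w (◇ ¬' ψ))
eval-sub-e e-ur       v w ψ = refl
eval-sub-e ◇e-ur      v w ψ = refl
eval-sub-e ◇¬e-ur     v w ψ = refl
eval-sub-e (¬-ur u)   v w ψ = cong not (eval-sub-e u v w ψ)
eval-sub-e (∨-ur u t) v w ψ = cong₂ _∨_ (eval-sub-e u v w ψ) (eval-sub-e t v w ψ)

eval-ur : ∀ {ρ} (u : UR ρ) v w → eval v w ρ ≡ value u (v 0) (w (◇ e)) (w (◇ ¬' e))
eval-ur e-ur       v w = refl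
eval-ur ◇e-ur      v w = refl
eval-ur ◇¬e-ur     v w = refl
eval-ur (¬-ur u)   v w = cong not (eval-ur u v w)
eval-ur (∨-ur u t) v w = cong₂ _∨_ (eval-ur u v w) (eval-ur t v w)

-- Composition turns `◇ e` into `ρ′(e)` and `◇ ¬' e` into `ρ′(¬e)`. The latter brings in
-- `◇ ¬' ¬' e`, which `w` may value differently from `◇ e`; the two are identified only in
-- `act-∘⇒≈`.
eval-ur-* : ∀ {ρ ρ′} (u : UR ρ) (t : UR ρ′) v w → eval v w (ρ * ρ′) ≡
            value u (v 0) (value t (v 0) (w (◇ e)) (w (◇ ¬' e)))
                          (value t (not (v 0)) (w (◇ ¬' e)) (w (◇ ¬' ¬' e)))
eval-ur-* e-ur       t v w = refl
eval-ur-* ◇e-ur      t v w = eval-sub-e t v w e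
eval-ur-* ◇¬e-ur     t v w = eval-sub-e t v w (¬' e)
eval-ur-* (¬-ur u)   t v w = cong not (eval-ur-* u t v w)
eval-ur-* (∨-ur u s) t v w = cong₂ _∨_ (eval-ur-* u t v w) (eval-ur-* s t v w)

-- Algebra of _*_

-- A UR has no variable besides `e`, so `σ` meets only the inserted copies of `ψ`.
subst-sub-e : ∀ {ρ} → UR ρ → ∀ σ ψ → subst σ (sub-e ψ ρ) ≡ sub-e (subst σ ψ) ρ
subst-sub-e e-ur       σ ψ = refl
subst-sub-e ◇e-ur      σ ψ = refl
subst-sub-e ◇¬e-ur     σ ψ = refl
subst-sub-e (¬-ur u)   σ ψ = cong ¬'_ (subst-sub-e u σ ψ)
subst-sub-e (∨-ur u t) σ ψ = cong₂ _∨'_ (subst-sub-e u σ ψ) (subst-sub-e t σ ψ)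

-- The substitution `τ` is tied to `σ` only pointwise. This covers both `τ n = σ n * ρ` and the
-- substitutions hidden in `sub-e`, without function extensionality.
subst-* : ∀ {ρ} → UR ρ → ∀ {σ τ} → (∀ n → σ n * ρ ≡ τ n) →
          ∀ φ → subst σ φ * ρ ≡ subst τ (φ * ρ)
subst-* u h (var n)  = h n
subst-* u h ⊥'       = refl
subst-* u h ⊤'       = refl
subst-* u h (¬' φ)   = cong ¬'_ (subst-* u h φ)
subst-* u h (φ ∨' ψ) = cong₂ _∨'_ (subst-* u h φ) (subst-* u h ψ)
subst-* {ρ} u {τ = τ} h (◇ φ) =
  trans (cong (λ ψ → sub-e ψ ρ) (subst-* u h φ)) (sym (subst-sub-e u τ (φ * ρ)))

sub-e-* : ∀ {ρ} → UR ρ → ∀ ψ χ → sub-e ψ χ * ρ ≡ sub-e (ψ * ρ) (χ * ρ)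
sub-e-* u ψ χ = subst-* u (λ where zero → refl ; (suc n) → refl) χ

*-assoc : ∀ {ρ ρ′} → UR ρ′ → ∀ φ → (φ * ρ) * ρ′ ≡ φ * (ρ * ρ′)
*-assoc u (var n)  = refl
*-assoc u ⊥'       = refl
*-assoc u ⊤'       = refl
*-assoc u (¬' φ)   = cong ¬'_ (*-assoc u φ)
*-assoc u (φ ∨' ψ) = cong₂ _∨'_ (*-assoc u φ) (*-assoc u ψ)
*-assoc {ρ} {ρ′} u (◇ φ) =
  trans (sub-e-* u (φ * ρ) ρ) (cong (λ ψ → sub-e ψ (ρ * ρ′)) (*-assoc u φ))

*-identityʳ : ∀ φ → φ * (◇ e) ≡ φ
*-identityʳ (var n)  = refl
*-identityʳ ⊥'       = refl
*-identityʳ ⊤'       = refl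
*-identityʳ (¬' φ)   = cong ¬'_ (*-identityʳ φ)
*-identityʳ (φ ∨' ψ) = cong₂ _∨'_ (*-identityʳ φ) (*-identityʳ ψ)
*-identityʳ (◇ φ)    = cong ◇_ (*-identityʳ φ)

*-congʳ : ∀ {ρ ρ′} φ → ρ ≈ ρ′ → (φ * ρ) ≈ (φ * ρ′)
*-congʳ (var n)  h = ≈-refl
*-congʳ ⊥'       h = ≈-refl
*-congʳ ⊤'       h = ≈-refl
*-congʳ (¬' φ)   h = ≈-¬-cong (*-congʳ φ h)
*-congʳ (φ ∨' ψ) h = ≈-∨-cong (*-congʳ φ h) (*-congʳ ψ h)
-- First the argument changes inside `ρ`; then `ρ` itself is exchanged for `ρ′` by substituting
-- `φ * ρ′` for `e` in `h`.
*-congʳ {ρ} (◇ φ) h = ≈-trans (≈-sub-e-cong ρ (*-congʳ φ h)) (us _ h)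

-- Giving each modal atom the value of its own translation is again an admissible choice of `w`, so
-- `_* ρ` preserves tautologies.
eval-* : ∀ {ρ} φ v w → eval v w (φ * ρ) ≡ eval v (λ χ → eval v w (χ * ρ)) φ
eval-* (var n)  v w = refl
eval-* ⊥'       v w = refl
eval-* ⊤'       v w = refl
eval-* (¬' φ)   v w = cong not (eval-* φ v w)
eval-* (φ ∨' ψ) v w = cong₂ _∨_ (eval-* φ v w) (eval-* ψ v w)
eval-* (◇ φ)    v w = refl

-- Preimages of logics

-- Preimages are the convenient side: `_* ρ` commutes with the connectives, so the closure rules
-- pull back directly along any UR, without an inverse.
Preimage : Fm → FmSet → FmSet
Preimage ρ S φ = S (φ * ρ)

module _ {ρ} (u : UR ρ) {S} (L : ClassicalLogic S) where

  preimage-E : ∀ {φ} → E φ → S (φ * ρ)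
  preimage-E {φ} (taut t)     = L .containsE _ (taut λ v w → trans (eval-* φ v w) (t v _))
  preimage-E (E.mp p q)       = L .closedMP (preimage-E p) (preimage-E q)
  preimage-E (E.us {φ} σ p)   =
    transport S (sym (subst-* u (λ _ → refl) φ)) (L .closedUS (λ n → σ n * ρ) (preimage-E p))
  preimage-E (E.re p)         = Rules.sub-e-cong L ρ (preimage-E p)

  preimage-logic : ClassicalLogic (Preimage ρ S)
  preimage-logic .containsE _      = preimage-E
  preimage-logic .closedMP         = L .closedMP
  preimage-logic .closedUS {φ} σ p =
    transport S (sym (subst-* u (λ _ → refl) φ)) (L .closedUS (λ n → σ n * ρ) p)
  preimage-logic .closedRE         = Rules.sub-e-cong L ρ

-- The translation preserves theorems of E, and the translation of `φ ⇔' ψ` is definitionally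
-- `(φ * ρ) ⇔' (ψ * ρ)`.
*-congˡ : ∀ {ρ} → UR ρ → ∀ {φ ψ} → φ ≈ ψ → (φ * ρ) ≈ (ψ * ρ)
*-congˡ u = preimage-E u E-logic

≐-logic : ∀ {S T} → S ≐ T → ClassicalLogic S → ClassicalLogic T
≐-logic (to , from) L .containsE φ p = to _ (L .containsE φ p)
≐-logic (to , from) L .closedMP p q  = to _ (L .closedMP (from _ p) (from _ q))
≐-logic (to , from) L .closedUS σ p  = to _ (L .closedUS σ (from _ p))
≐-logic (to , from) L .closedRE p    = to _ (L .closedRE (from _ p))

≐-sym : ∀ {S T} → S ≐ T → T ≐ S
≐-sym (to , from) = from , to

≐-trans : ∀ {S T U} → S ≐ T → T ≐ U → S ≐ U
≐-trans (to , from) (to′ , from′) = (λ φ → to′ φ ∘ to φ) , (λ φ → from φ ∘ from′ φ)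

meet-logic : ∀ {S T} → ClassicalLogic S → ClassicalLogic T → ClassicalLogic (Meet S T)
meet-logic L M .containsE φ p              = L .containsE φ p , M .containsE φ p
meet-logic L M .closedMP (p , p′) (q , q′) = L .closedMP p q , M .closedMP p′ q′
meet-logic L M .closedUS σ (p , p′)        = L .closedUS σ p , M .closedUS σ p′
meet-logic L M .closedRE (p , p′)          = L .closedRE p , M .closedRE p′

join-logic : ∀ {S T} → ClassicalLogic S → ClassicalLogic (Join S T)
join-logic L .containsE φ p = inl (L .containsE φ p)
join-logic L .closedMP      = Join.mp
join-logic L .closedUS      = Join.us
join-logic L .closedRE      = Join.re

join-least : ∀ {S T U} → ClassicalLogic U → S ⊆ U → T ⊆ U → Join S T ⊆ U
join-least L s t _ (inl p)       = s _ p
join-least L s t _ (inr p)       = t _ p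
join-least L s t _ (Join.mp p q) = L .closedMP (join-least L s t _ p) (join-least L s t _ q)
join-least L s t _ (Join.us σ p) = L .closedUS σ (join-least L s t _ p)
join-least L s t _ (Join.re p)   = L .closedRE (join-least L s t _ p)

-- Invertible uniform replacements

-- The map applied last contributes the right factor, by associativity of `_*_`. Elements of the
-- inner image are known only up to `≈`, hence the appeal to `*-congˡ`.
Img-* : ∀ {ρ ρ′ π} → UR ρ → (ρ′ * ρ) ≈ π → ∀ S → Img π S ≐ Img ρ (Img ρ′ S)
Img-* {ρ} {ρ′} {π} u h S = to , from
  where
  comp : ∀ φ → ((φ * ρ′) * ρ) ≈ (φ * π)
  comp φ = ≈-trans (≈-reflexive (*-assoc u φ)) (*-congʳ φ h)
  to : Img π S ⊆ Img ρ (Img ρ′ S)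
  to ψ (φ , s , p) = φ * ρ′ , (φ , s , ≈-refl) , ≈-trans p (≈-sym (comp φ))
  from : Img ρ (Img ρ′ S) ⊆ Img π S
  from ψ (χ , (φ , s , q) , p) = φ , s , ≈-trans p (≈-trans (*-congˡ u q) (comp φ))

Img-cong : ∀ {ρ ρ′} → ρ ≈ ρ′ → ∀ S → Img ρ S ≐ Img ρ′ S
Img-cong h S = (λ ψ (φ , s , p) → φ , s , ≈-trans p (*-congʳ φ h))
             , (λ ψ (φ , s , p) → φ , s , ≈-trans p (≈-sym (*-congʳ φ h)))

Img-identity : ∀ {S} → ClassicalLogic S → Img (◇ e) S ≐ S
Img-identity L =
    (λ ψ (φ , s , p) → Rules.resp-≈ L (≈-sym (≈-trans p (≈-reflexive (*-identityʳ φ)))) s)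
  , (λ ψ s → ψ , s , ≈-reflexive (sym (*-identityʳ ψ)))

module Invertible {ρ ρ⁻¹ : Fm} (u : UR ρ) (u⁻¹ : UR ρ⁻¹)
                  (ρρ⁻¹ : (ρ * ρ⁻¹) ≈ (◇ e)) (ρ⁻¹ρ : (ρ⁻¹ * ρ) ≈ (◇ e)) where

  cancel : ∀ φ → ((φ * ρ) * ρ⁻¹) ≈ φ
  cancel φ = ≈-trans (≈-reflexive (*-assoc u⁻¹ φ))
             (≈-trans (*-congʳ φ ρρ⁻¹) (≈-reflexive (*-identityʳ φ)))

  cancel⁻¹ : ∀ φ → ((φ * ρ⁻¹) * ρ) ≈ φ
  cancel⁻¹ φ = ≈-trans (≈-reflexive (*-assoc u φ))
               (≈-trans (*-congʳ φ ρ⁻¹ρ) (≈-reflexive (*-identityʳ φ)))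

  -- Applying `ρ⁻¹` to `ψ ≈ φ * ρ` recovers `φ` up to `≈`; conversely `ψ * ρ⁻¹` serves as the
  -- witness for `ψ`.
  Img≐Preimage : ∀ {S} → ClassicalLogic S → Img ρ S ≐ Preimage ρ⁻¹ S
  Img≐Preimage L =
      (λ ψ (φ , s , p) → Rules.resp-≈ L (≈-sym (≈-trans (*-congˡ u⁻¹ p) (cancel φ))) s)
    , (λ ψ s → ψ * ρ⁻¹ , s , ≈-sym (cancel⁻¹ ψ))

  Img-logic : ∀ S → ClassicalLogic S → ClassicalLogic (Img ρ S)
  Img-logic S L = ≐-logic (≐-sym (Img≐Preimage L)) (preimage-logic u⁻¹ L)

  Img-reflects-⊆ : ∀ {S T} → ClassicalLogic T → Img ρ S ⊆ Img ρ T → S ⊆ T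
  Img-reflects-⊆ M h φ s =
    Rules.resp-≈ M (cancel φ) (Img≐Preimage M .proj₁ _ (h _ (φ , s , ≈-refl)))

  Img-surjective : ∀ T → ClassicalLogic T → Σ FmSet λ S → ClassicalLogic S × (Img ρ S ≐ T)
  Img-surjective T M = Preimage ρ T , preimage-logic u M ,
    ≐-trans (Img≐Preimage (preimage-logic u M))
      ( (λ φ → Rules.resp-≈ M (cancel⁻¹ φ)) , (λ φ → Rules.resp-≈ M (≈-sym (cancel⁻¹ φ))))

  Img-meet : ∀ S T → ClassicalLogic S → ClassicalLogic T →
             Img ρ (Meet S T) ≐ Meet (Img ρ S) (Img ρ T)
  Img-meet S T L M =
      (λ ψ (φ , (s , t) , p) → (φ , s , p) , (φ , t , p))
    -- The two memberships may come with different witnesses; passing to preimages replaces both by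
    -- `ψ * ρ⁻¹`.
    , (λ ψ (s , t) → Img≐Preimage (meet-logic L M) .proj₂ ψ
                       (Img≐Preimage L .proj₁ ψ s , Img≐Preimage M .proj₁ ψ t))

  Img-join : ∀ S T → ClassicalLogic S → ClassicalLogic T →
             Img ρ (Join S T) ≐ Join (Img ρ S) (Img ρ T)
  Img-join S T L M = to , from
    where
    J : ClassicalLogic (Join (Img ρ S) (Img ρ T))
    J = join-logic (Img-logic S L)
    to : Img ρ (Join S T) ⊆ Join (Img ρ S) (Img ρ T)
    to ψ (φ , s , p) = Rules.resp-≈ J (≈-sym p)
      -- The preimage of `J` under `ρ` is a logic containing `S` and `T`, hence it contains their
      -- join.
      (join-least (preimage-logic u J)
        (λ χ s → inl (χ , s , ≈-refl)) (λ χ t → inr (χ , t , ≈-refl)) φ s)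
    from : Join (Img ρ S) (Img ρ T) ⊆ Img ρ (Join S T)
    from = join-least (Img-logic (Join S T) (join-logic L))
      (λ ψ (φ , s , p) → φ , inl s , p) (λ ψ (φ , t , p) → φ , inr t , p)

  Img-automorphism : IsAutomorphism (Img ρ)
  Img-automorphism =
      Img-logic
    , (λ S T L M (to , from) → Img-reflects-⊆ M to , Img-reflects-⊆ L from)
    , Img-surjective
    , Img-meet
    , Img-join

-- The action on states

State : Set
State = Fin 4

◇T ◇F : State → Bool
◇T 0F = false
◇T 1F = false
◇T 2F = true
◇T 3F = true
◇F 0F = false
◇F 1F = true
◇F 2F = false
◇F 3F = true

state : Bool → Bool → State
state false false = 0F
state false true  = 1F
state true  false = 2F
state true  true  = 3F

◇T-state : ∀ x y → ◇T (state x y) ≡ x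
◇T-state false false = refl
◇T-state false true  = refl
◇T-state true  false = refl
◇T-state true  true  = refl

◇F-state : ∀ x y → ◇F (state x y) ≡ y
◇F-state false false = refl
◇F-state false true  = refl
◇F-state true  false = refl
◇F-state true  true  = refl

state-η : ∀ s → state (◇T s) (◇F s) ≡ s
state-η 0F = refl
state-η 1F = refl
state-η 2F = refl
state-η 3F = refl

-- If e is false, then ◇e is ◇F and ◇¬e is ◇T.
ur-act : ∀ {ρ} → UR ρ → State → State
ur-act u s = state (value u true (◇T s) (◇F s)) (value u false (◇F s) (◇T s))

ur-act-true : ∀ {ρ} (u : UR ρ) x y → value u true x y ≡ ◇T (ur-act u (state x y))
ur-act-true u x y = sym (trans (◇T-state _ _) (cong₂ (value u true) (◇T-state x y) (◇F-state x y)))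

ur-act-false : ∀ {ρ} (u : UR ρ) x y → value u false y x ≡ ◇F (ur-act u (state x y))
ur-act-false u x y = sym (trans (◇F-state _ _) (cong₂ (value u false) (◇F-state x y) (◇T-state x y)))

act-state : ∀ {ρ} (u : UR ρ) x y → ur-act u (state x y) ≡ state (value u true x y) (value u false y x)
act-state u x y rewrite ◇T-state x y | ◇F-state x y = refl

act-≡⇒value-≡ : ∀ {ρ ρ′} (u : UR ρ) (u′ : UR ρ′) → (∀ s → ur-act u s ≡ ur-act u′ s) →
                ∀ a x y → value u a x y ≡ value u′ a x y
act-≡⇒value-≡ u u′ h true  x y =
  trans (ur-act-true u x y) (trans (cong ◇T (h _)) (sym (ur-act-true u′ x y)))
-- With `e` false the roles swap: `x` is the value of `◇` at falsity and `y` at truth, so the state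
-- is `state y x`.
act-≡⇒value-≡ u u′ h false x y =
  trans (ur-act-false u y x) (trans (cong ◇F (h _)) (sym (ur-act-false u′ y x)))

act-≡⇒≈ : ∀ {ρ ρ′} (u : UR ρ) (u′ : UR ρ′) → (∀ s → ur-act u s ≡ ur-act u′ s) → ρ ≈ ρ′
act-≡⇒≈ u u′ h = taut λ v w → ≡⇒iff
  (trans (eval-ur u v w) (trans (act-≡⇒value-≡ u u′ h _ _ _) (sym (eval-ur u′ v w))))

-- In `ρ * ρ′` the state is first transformed by `ρ′`, and `ρ` then reads the result as its own `◇`.
-- The last argument `x` in the second call of `u′` stands for `◇ ¬' ¬' e` already identified with
-- `◇ e`.
act-∘⇒value : ∀ {ρ ρ′ π} (u : UR ρ) (u′ : UR ρ′) (t : UR π) →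
              (∀ s → ur-act t s ≡ ur-act u (ur-act u′ s)) →
              ∀ a x y → value u a (value u′ a x y) (value u′ (not a) y x) ≡ value t a x y
act-∘⇒value u u′ t h true x y = begin
  value u true (value u′ true x y) (value u′ false y x)              ≡⟨ ur-act-true u _ _ ⟩
  ◇T (ur-act u (state (value u′ true x y) (value u′ false y x)))     ≡⟨ cong (◇T ∘ ur-act u) (act-state u′ x y) ⟨
  ◇T (ur-act u (ur-act u′ (state x y)))                              ≡⟨ cong ◇T (h _) ⟨
  ◇T (ur-act t (state x y))                                          ≡⟨ ur-act-true t x y ⟨
  value t true x y                                                   ∎
  where open ≡-Reasoning
act-∘⇒value u u′ t h false x y = begin
  value u false (value u′ false x y) (value u′ true y x)             ≡⟨ ur-act-false u _ _ ⟩
  ◇F (ur-act u (state (value u′ true y x) (value u′ false x y)))     ≡⟨ cong (◇F ∘ ur-act u) (act-state u′ y x) ⟨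
  ◇F (ur-act u (ur-act u′ (state y x)))                              ≡⟨ cong ◇F (h _) ⟨
  ◇F (ur-act t (state y x))                                          ≡⟨ ur-act-false t y x ⟨
  value t false x y                                                  ∎
  where open ≡-Reasoning

◇¬¬-elim : ∀ {φ} → (◇ ¬' ¬' φ) ≈ (◇ φ)
◇¬¬-elim {φ} = re (taut λ v w → ≡⇒iff (not-involutive (eval v w φ)))

-- The atom `◇ ¬' ¬' e` can keep the equivalence from being a tautology, but it follows
-- propositionally from the single E-theorem `◇ ¬' ¬' e ⇔' ◇ e`.
act-∘⇒≈ : ∀ {ρ ρ′ π} (u : UR ρ) (u′ : UR ρ′) (t : UR π) →
          (∀ s → ur-act t s ≡ ur-act u (ur-act u′ s)) → (ρ * ρ′) ≈ π
act-∘⇒≈ {ρ} {ρ′} {π} u u′ t h = E-entail₁ {_} {(ρ * ρ′) ⇔' π} sound (◇¬¬-elim {e})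
  where
  sound : ∀ v w → iff (w (◇ ¬' ¬' e)) (w (◇ e)) ≡ true → eval v w ((ρ * ρ′) ⇔' π) ≡ true
  sound v w k = ≡⇒iff (begin
    eval v w (ρ * ρ′)                                          ≡⟨ eval-ur-* u u′ v w ⟩
    value u a (value u′ a x y) (value u′ (not a) y (w (◇ ¬' ¬' e))) ≡⟨ cong (λ z → value u a (value u′ a x y) (value u′ (not a) y z)) (iff⇒≡ _ x k) ⟩
    value u a (value u′ a x y) (value u′ (not a) y x)          ≡⟨ act-∘⇒value u u′ t h a x y ⟩
    value t a x y                                              ≡⟨ eval-ur t v w ⟨
    eval v w π                                                 ∎)
    where
    open ≡-Reasoning
    a = v 0
    x = w (◇ e)
    y = w (◇ ¬' e)

-- One-point frames

dia : State → Bool → Bool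
dia s a = if a then ◇T s else ◇F s

frame : State → (ℕ → Bool) → Fm → Bool
frame s v (var n)  = v n
frame s v ⊥'       = false
frame s v ⊤'       = true
frame s v (¬' φ)   = not (frame s v φ)
frame s v (φ ∨' ψ) = frame s v φ ∨ frame s v ψ
frame s v (◇ φ)    = dia s (frame s v φ)

Valid : State → FmSet
Valid s φ = ∀ v → frame s v φ ≡ true

frame-eval : ∀ s v φ → frame s v φ ≡ eval v (frame s v) φ
frame-eval s v (var n)  = refl
frame-eval s v ⊥'       = refl
frame-eval s v ⊤'       = refl
frame-eval s v (¬' φ)   = cong not (frame-eval s v φ)
frame-eval s v (φ ∨' ψ) = cong₂ _∨_ (frame-eval s v φ) (frame-eval s v ψ)
frame-eval s v (◇ φ)    = refl

frame-subst : ∀ s v σ φ → frame s v (subst σ φ) ≡ frame s (λ n → frame s v (σ n)) φ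
frame-subst s v σ (var n)  = refl
frame-subst s v σ ⊥'       = refl
frame-subst s v σ ⊤'       = refl
frame-subst s v σ (¬' φ)   = cong not (frame-subst s v σ φ)
frame-subst s v σ (φ ∨' ψ) = cong₂ _∨_ (frame-subst s v σ φ) (frame-subst s v σ ψ)
frame-subst s v σ (◇ φ)    = cong (dia s) (frame-subst s v σ φ)

E-valid : ∀ s {φ} → E φ → Valid s φ
E-valid s {φ} (taut t)   v = trans (frame-eval s v φ) (t v _)
E-valid s (E.mp p q)     v = true-⇒ (E-valid s p v) (E-valid s q v)
E-valid s (E.us {φ} σ p) v = trans (frame-subst s v σ φ) (E-valid s p _)
E-valid s (E.re {φ} {ψ} p) v =
  ≡⇒iff (cong (dia s) (iff⇒≡ (frame s v φ) (frame s v ψ) (E-valid s p v)))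

Valid-logic : ∀ s → ClassicalLogic (Valid s)
Valid-logic s .containsE _ p = E-valid s p
Valid-logic s .closedMP p q v = true-⇒ (p v) (q v)
Valid-logic s .closedUS {φ} σ p v = trans (frame-subst s v σ φ) (p _)
Valid-logic s .closedRE {φ} {ψ} p v =
  ≡⇒iff (cong (dia s) (iff⇒≡ (frame s v φ) (frame s v ψ) (p v)))

frame-sub-e : ∀ {ρ} (u : UR ρ) s v ψ → frame s v (sub-e ψ ρ) ≡
              value u (frame s v ψ) (dia s (frame s v ψ)) (dia s (not (frame s v ψ)))
frame-sub-e e-ur       s v ψ = refl
frame-sub-e ◇e-ur      s v ψ = refl
frame-sub-e ◇¬e-ur     s v ψ = refl
frame-sub-e (¬-ur u)   s v ψ = cong not (frame-sub-e u s v ψ)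
frame-sub-e (∨-ur u t) s v ψ = cong₂ _∨_ (frame-sub-e u s v ψ) (frame-sub-e t s v ψ)

value-dia : ∀ {ρ} (u : UR ρ) s a → value u a (dia s a) (dia s (not a)) ≡ dia (ur-act u s) a
value-dia u s true  = sym (◇T-state _ _)
value-dia u s false = sym (◇F-state (value u true (◇T s) (◇F s)) _)

-- On a one-point frame `ρ` defines a new operator from the old `◇`, and its state is by
-- construction `ur-act u s`.
frame-* : ∀ {ρ} (u : UR ρ) s v φ → frame s v (φ * ρ) ≡ frame (ur-act u s) v φ
frame-* u s v (var n)  = refl
frame-* u s v ⊥'       = refl
frame-* u s v ⊤'       = refl
frame-* u s v (¬' φ)   = cong not (frame-* u s v φ)
frame-* u s v (φ ∨' ψ) = cong₂ _∨_ (frame-* u s v φ) (frame-* u s v ψ)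
frame-* {ρ} u s v (◇ φ) = trans (frame-sub-e u s v (φ * ρ))
  (trans (value-dia u s _) (cong (dia (ur-act u s)) (frame-* u s v φ)))

literal : Bool → Fm → Fm
literal true  φ = φ
literal false φ = ¬' φ

-- A variable-free description of the state: `◇ ⊤'` takes the value `◇T` and `◇ ⊥'` the value `◇F`.
characteristic : State → Fm
characteristic s = literal (◇T s) (◇ ⊤') ∧' literal (◇F s) (◇ ⊥')

characteristic-valid : ∀ s → Valid s (characteristic s)
characteristic-valid 0F v = refl
characteristic-valid 1F v = refl
characteristic-valid 2F v = refl
characteristic-valid 3F v = refl

frame-literal : ∀ b φ s v → frame s v (literal b φ) ≡ iff b (frame s v φ)
frame-literal true  φ s v with frame s v φ
... | true  = refl
... | false = refl
frame-literal false φ s v with frame s v φ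
... | true  = refl
... | false = refl

∧-true : ∀ a b → not (not a ∨ not b) ≡ true → a ≡ true × b ≡ true
∧-true true true _ = refl , refl

characteristic-unique : ∀ s t v → frame t v (characteristic s) ≡ true → t ≡ s
characteristic-unique s t v h with ∧-true (frame t v (literal (◇T s) (◇ ⊤'))) _ h
... | p , q = begin
  t                    ≡⟨ state-η t ⟨
  state (◇T t) (◇F t)  ≡⟨ cong₂ state (bit (◇ ⊤') p) (bit (◇ ⊥') q) ⟨
  state (◇T s) (◇F s)  ≡⟨ state-η s ⟩
  s                    ∎
  where
  open ≡-Reasoning
  bit : ∀ {b} φ → frame t v (literal b φ) ≡ true → b ≡ frame t v φ
  bit {b} φ r = iff⇒≡ b _ (trans (sym (frame-literal b φ t v)) r)

-- Test the inclusion on the logic of the frame `t = ur-act u′ s`. The translated characteristic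
-- formula of `t` is equivalent to some `φ * ρ′` with `φ` valid at `t`, so it is true at `s`. Hence
-- the characteristic formula holds at `ur-act u s`, which must then be `t`.
Img-faithful : ∀ {ρ ρ′} (u : UR ρ) (u′ : UR ρ′) →
               (∀ S → ClassicalLogic S → Img ρ S ⊆ Img ρ′ S) → ∀ s → ur-act u s ≡ ur-act u′ s
Img-faithful {ρ} {ρ′} u u′ h s = characteristic-unique t _ v (begin
    frame (ur-act u s) v χ  ≡⟨ frame-* u s v χ ⟨
    frame s v (χ * ρ)       ≡⟨ iff⇒≡ _ _ (E-valid s χρ≈φρ′ v) ⟩
    frame s v (φ * ρ′)      ≡⟨ frame-* u′ s v φ ⟩
    frame t v φ             ≡⟨ φ-valid v ⟩
    true                    ∎)
  where
  open ≡-Reasoning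
  t = ur-act u′ s
  χ = characteristic t
  v : ℕ → Bool
  v _ = false
  witness : Img ρ′ (Valid t) (χ * ρ)
  witness = h (Valid t) (Valid-logic t) _ (χ , characteristic-valid t , ≈-refl)
  φ = witness .proj₁
  φ-valid = witness .proj₂ .proj₁
  χρ≈φρ′ = witness .proj₂ .proj₂

-- The prime uniform replacements are the permutations of the states

act : PrimeIdx → State → State
act i = ur-act (prime-ur i)

idx₀ : PrimeIdx
idx₀ = false , false , 0F

act-idx₀ : ∀ s → act idx₀ s ≡ s
act-idx₀ = state-η

-- Exhaustive search over the prime indices

anyBool? : {P : Bool → Set} → Decidable P → Dec (∃ P)
anyBool? P? = map′ [ (false ,_) , (true ,_) ]
                   (λ where (false , p) → inj₁ p ; (true , p) → inj₂ p)
                   (P? false ⊎-dec P? true)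

allBool? : {P : Bool → Set} → Decidable P → Dec (∀ b → P b)
allBool? P? = map′ (λ where (p , q) false → p ; (p , q) true → q)
                   (λ h → h false , h true)
                   (P? false ×-dec P? true)

anyIdx? : {P : PrimeIdx → Set} → Decidable P → Dec (∃ P)
anyIdx? P? = map′ (λ (d , n , t , p) → (d , n , t) , p) (λ ((d , n , t) , p) → d , n , t , p)
  (anyBool? λ d → anyBool? λ n → any? λ t → P? (d , n , t))

allIdx? : {P : PrimeIdx → Set} → Decidable P → Dec (∀ i → P i)
allIdx? P? = map′ (λ h (d , n , t) → h d n t) (λ h d n t → h (d , n , t))
  (allBool? λ d → allBool? λ n → all? λ t → P? (d , n , t))

-- The witnesses come from an exhaustive search, which must not be unfolded
-- in later conversion checks.
abstract
  act-inverse : ∀ i → ∃ λ j → ∀ s → act i (act j s) ≡ s × act j (act i s) ≡ s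
  act-inverse = from-yes (allIdx? λ i → anyIdx? λ j → all? λ s →
    (act i (act j s) ≟ s) ×-dec (act j (act i s) ≟ s))

Distinct : (a b c d : State) → Set
Distinct a b c d = a ≢ b × a ≢ c × a ≢ d × b ≢ c × b ≢ d × c ≢ d

distinct? : ∀ a b c d → Dec (Distinct a b c d)
distinct? a b c d = ¬? (a ≟ b) ×-dec ¬? (a ≟ c) ×-dec ¬? (a ≟ d) ×-dec
                    ¬? (b ≟ c) ×-dec ¬? (b ≟ d) ×-dec ¬? (c ≟ d)

abstract
  -- Listing a permutation by its four values makes the claim a decidable statement about finite
  -- types, open to brute force over 256 quadruples.
  act-realises-distinct : ∀ a b c d → Distinct a b c d →
    ∃ λ i → act i 0F ≡ a × act i 1F ≡ b × act i 2F ≡ c × act i 3F ≡ d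
  act-realises-distinct = from-yes (all? λ a → all? λ b → all? λ c → all? λ d →
    distinct? a b c d →-dec anyIdx? λ i →
      (act i 0F ≟ a) ×-dec (act i 1F ≟ b) ×-dec (act i 2F ≟ c) ×-dec (act i 3F ≟ d))

act-realises : ∀ (g : State → State) → (∀ {s t} → g s ≡ g t → s ≡ t) → ∃ λ i → ∀ s → act i s ≡ g s
act-realises g inj with act-realises-distinct (g 0F) (g 1F) (g 2F) (g 3F)
  ( (λ p → case inj p of λ ()) , (λ p → case inj p of λ ()) , (λ p → case inj p of λ ())
  , (λ p → case inj p of λ ()) , (λ p → case inj p of λ ()) , (λ p → case inj p of λ ()))
... | i , p , q , r , s = i , λ where
  0F → p
  1F → q
  2F → r
  3F → s

idx⁻¹ : PrimeIdx → PrimeIdx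
idx⁻¹ i = act-inverse i .proj₁

toPerm : PrimeIdx → Permutation′ 4
toPerm i = permutation (act i) (act (idx⁻¹ i))
  (λ s → act-inverse i .proj₂ s .proj₁) (λ s → act-inverse i .proj₂ s .proj₂)

realise : (π : Permutation′ 4) → ∃ λ i → ∀ s → act i s ≡ π ⟨$⟩ʳ s
realise π = act-realises (π ⟨$⟩ʳ_) (Injection.injective (Inverse⇒Injection π))

fromPerm : Permutation′ 4 → PrimeIdx
fromPerm π = realise π .proj₁

act-fromPerm : ∀ π s → act (fromPerm π) s ≡ π ⟨$⟩ʳ s
act-fromPerm π = realise π .proj₂

-- The group of the maps `f i` and its isomorphism with the permutations

f-cong : ∀ i j → (∀ s → act i s ≡ act j s) → f i ≗L f j
f-cong i j h S _ = Img-cong (act-≡⇒≈ (prime-ur i) (prime-ur j) h) S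

-- φ * ρⱼ * ρᵢ reads ◇ through ρᵢ first, so f is contravariant in the action.
f-∘ : ∀ i j k → (∀ s → act k s ≡ act j (act i s)) → f k ≗L (λ S → f i (f j S))
f-∘ i j k h S _ =
  Img-* (prime-ur i) (act-∘⇒≈ (prime-ur j) (prime-ur i) (prime-ur k) h) S

f-idx₀ : f idx₀ ≗L (λ S → S)
f-idx₀ S L = Img-identity L

f-∘-idx⁻¹ : ∀ i → (λ S → f i (f (idx⁻¹ i) S)) ≗L (λ S → S)
f-∘-idx⁻¹ i S L = ≐-trans (≐-sym (f-∘ i (idx⁻¹ i) idx₀
  -- By contravariance the required law is the one where `idx⁻¹ i` acts after `i`.
  (λ s → trans (act-idx₀ s) (sym (act-inverse i .proj₂ s .proj₂))) S L)) (f-idx₀ S L)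

f-automorphism : ∀ i → IsAutomorphism (f i)
f-automorphism i = Invertible.Img-automorphism u u⁻¹
    (act-∘⇒≈ u u⁻¹ ◇e-ur (λ s → trans (act-idx₀ s) (sym (act-inverse i .proj₂ s .proj₁))))
    (act-∘⇒≈ u⁻¹ u ◇e-ur (λ s → trans (act-idx₀ s) (sym (act-inverse i .proj₂ s .proj₂))))
  where
  u = prime-ur i
  u⁻¹ = prime-ur (idx⁻¹ i)

-- `π ∘ₚ π′` applies `π` first, which matches the contravariance of `f-∘`; the result is therefore a
-- homomorphism and not an anti-homomorphism.
fromPerm-∘ : ∀ π π′ → f (fromPerm (π ∘ₚ π′)) ≗L (λ S → f (fromPerm π) (f (fromPerm π′) S))
fromPerm-∘ π π′ = f-∘ (fromPerm π) (fromPerm π′) (fromPerm (π ∘ₚ π′)) λ s → begin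
    act (fromPerm (π ∘ₚ π′)) s           ≡⟨ act-fromPerm (π ∘ₚ π′) s ⟩
    π′ ⟨$⟩ʳ (π ⟨$⟩ʳ s)                   ≡⟨ act-fromPerm π′ _ ⟨
    act (fromPerm π′) (π ⟨$⟩ʳ s)         ≡⟨ cong (act (fromPerm π′)) (act-fromPerm π s) ⟨
    act (fromPerm π′) (act (fromPerm π) s) ∎
  where open ≡-Reasoning

fromPerm-toPerm : ∀ i → f (fromPerm (toPerm i)) ≗L f i
fromPerm-toPerm i = f-cong (fromPerm (toPerm i)) i (act-fromPerm (toPerm i))

-- The product index needs no further search: it realises the composite of the two state
-- permutations.
f-closed-∘ : ∀ i j → Σ PrimeIdx λ k → f k ≗L (λ S → f i (f j S))
f-closed-∘ i j = k , f-∘ i j k (act-fromPerm (toPerm i ∘ₚ toPerm j))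
  where
  k = fromPerm (toPerm i ∘ₚ toPerm j)

fromPerm-injective : ∀ π π′ → f (fromPerm π) ≗L f (fromPerm π′) →
                     ∀ s → π ⟨$⟩ʳ s ≡ π′ ⟨$⟩ʳ s
fromPerm-injective π π′ h s =
  trans (sym (act-fromPerm π s))
    (trans (Img-faithful (prime-ur (fromPerm π)) (prime-ur (fromPerm π′))
             (λ S L → h S L .proj₁) s)
           (act-fromPerm π′ s))

theorem15 : ((i : PrimeIdx) → IsAutomorphism (f i)) × IsGroupOfMaps × IsoToS4
theorem15 =
    f-automorphism
  , (f-closed-∘ , (idx₀ , f-idx₀) , (λ i → idx⁻¹ i , f-∘-idx⁻¹ i))
  , (fromPerm , fromPerm-∘ , fromPerm-injective , λ i → toPerm i , fromPerm-toPerm i)
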